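{- For all integers $k\ge 2$ and $n\ge 1$, $$\mathrm{spt}(k-1)'_{do}(n-1)-\mathrm{spt}k'_{do}(n)=\mathrm{spt}(k-1)'_{do}(n-2k+1)+p'_{do}(n-2k+1),$$ and $$\mathrm{spt}k_{do}(n)+\mathrm{spt}(k-1)_{do}(n-1)=\mathrm{spt}(k-1)_{do}(n-2k+1)+2p_{de}(n-k)+p_{do}(n-2k+1).$$
   Context: For a partition $\pi$, $s(\pi)$ is its smallest part. For $j\ge1$, $\mathrm{Spt}j_{do}(n)$ is the set of partitions $\pi$ of $n$ in which $s(\pi)$ occurs exactly $j$ times and the remaining parts (those larger than $s(\pi)$) are pairwise distinct and each has parity different from that of $s(\pi)$. $B_0(j,n)$ (resp. $B_1(j,n)$) is the number of $\pi\in\mathrm{Spt}j_{do}(n)$ whose number of parts greater than $s(\pi)$ is even (resp. odd). $\mathrm{spt}j_{do}(n)=B_0(j,n)+B_1(j,n)$ and $\mathrm{spt}j'_{do}(n)=B_0(j,n)-B_1(j,n)$; all of these are $0$ for $n\le 0$. $p_{de}(n)$ (resp. $p_{do}(n)$) is the number of partitions of $n$ into distinct even (resp. distinct odd) parts; $p'_{do}(n)$ is the number of partitions of $n$ into distinct odd parts with an even number of parts minus the number with an odd number of parts. These three functions equal $1$ at $n=0$ and $0$ for $n<0$. -}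

module Defs where

open import Data.Integer.Base as ℤ using (ℤ; +_; -[1+_])
open import Data.List.Base using (List; []; _∷_; length; filter; map; concatMap; upTo)
open import Data.List.Extrema.Nat using (min)
open import Data.List.Membership.Propositional using (_∈_; find; lose)
open import Data.List.Membership.Propositional.Properties using (∈-concatMap⁺; ∈-concatMap⁻; ∈-map⁺; ∈-map⁻; ∈-upTo⁺; ∈-upTo⁻)
open import Data.List.Properties using (∷-injectiveˡ; ∷-injectiveʳ)
open import Data.List.Relation.Binary.Disjoint.Propositional using (Disjoint)
open import Data.List.Relation.Unary.All as All using (All; []; _∷_; all?)
import Data.List.Relation.Unary.All.Properties as All
open import Data.List.Relation.Unary.AllPairs as AllPairs using ([]; _∷_)
import Data.List.Relation.Unary.AllPairs.Properties as AllPairs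
open import Data.List.Relation.Unary.Any using (here)
open import Data.List.Relation.Unary.Linked as Linked using (Linked; []; [-]; _∷_)
open import Data.List.Relation.Unary.Unique.Propositional using (Unique)
import Data.List.Relation.Unary.Unique.Propositional.Properties as Unique
open import Data.Nat.Base using (ℕ; zero; suc; _+_; _∸_; _⊓_; _≤_; _≥_; _<_; z≤n; s≤s; s≤s⁻¹; parity)
open import Data.Nat.ListAction using (sum)
open import Data.Nat.Properties
open import Data.List.Relation.Unary.Unique.DecPropositional _≟_ using (unique?)
open import Data.Parity.Base using (Parity; 0ℙ; 1ℙ)
import Data.Parity.Properties as ℙ
open import Data.Product.Base using (_×_; _,_)
open import Relation.Binary.PropositionalEquality using (_≡_; _≢_; refl; sym; trans; cong)
open import Relation.Nullary.Decidable using (yes; no; _×-dec_; ¬?)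
open import Relation.Unary using (Decidable)

-- A partition is the list of its parts in weakly decreasing order.

record IsPartition (n : ℤ) (π : List ℕ) : Set where
  constructor mkPartition
  field
    decreasing : Linked _≥_ π
    positive   : All (0 <_) π
    total      : + sum π ≡ n

-- Partitions of n with parts at most m.  The first argument bounds the
-- number of parts and is only there for termination.

partitions≤ : ℕ → ℕ → ℕ → List (List ℕ)
partitions≤ _       m zero    = [] ∷ []
partitions≤ zero    m (suc n) = []
partitions≤ (suc l) m (suc n) =
  concatMap (λ i → map (suc i ∷_) (partitions≤ l (suc i) (n ∸ i))) (upTo (m ⊓ suc n))

partitions : ℤ → List (List ℕ)
partitions (+ n)    = partitions≤ n n n
partitions -[1+ _ ] = []

-- The list `partitions n` contains every partition of n exactly once:
-- see partitions-sound, partitions-complete and partitions-unique below.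

count : {P : List ℕ → Set} → Decidable P → ℤ → ℕ
count P? n = length (filter P? (partitions n))

-- The value at [] is a dummy; IsSptDo excludes the empty partition.

smallest : List ℕ → ℕ
smallest []       = 0
smallest (x ∷ xs) = min x xs

occurrences : ℕ → List ℕ → ℕ
occurrences s π = length (filter (_≟ s) π)

larger : List ℕ → List ℕ
larger π = filter (smallest π <?_) π

IsSptDo : ℕ → List ℕ → Set
IsSptDo j π =
    π ≢ []
  × occurrences (smallest π) π ≡ j
  × Unique (larger π)
  × All (λ p → parity p ≢ parity (smallest π)) (larger π)

nonempty? : Decidable {A = List ℕ} (_≢ [])
nonempty? []      = no λ []≢[] → []≢[] refl
nonempty? (_ ∷ _) = yes λ ()

isSptDo? : ∀ j → Decidable (IsSptDo j)
isSptDo? j π =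
  nonempty? π
  ×-dec (occurrences (smallest π) π ≟ j)
  ×-dec unique? (larger π)
  ×-dec all? (λ p → ¬? (parity p ℙ.≟ parity (smallest π))) (larger π)

B : Parity → ℕ → ℤ → ℕ
B ε j = count (λ π → isSptDo? j π ×-dec (parity (length (larger π)) ℙ.≟ ε))

B₀ B₁ : ℕ → ℤ → ℕ
B₀ = B 0ℙ
B₁ = B 1ℙ

spt-do : ℕ → ℤ → ℕ
spt-do j n = B₀ j n + B₁ j n

spt′-do : ℕ → ℤ → ℤ
spt′-do j n = + B₀ j n ℤ.- + B₁ j n

DistinctParts : Parity → List ℕ → Set
DistinctParts ε π = Unique π × All (λ p → parity p ≡ ε) π

distinctParts? : ∀ ε → Decidable (DistinctParts ε)
distinctParts? ε π = unique? π ×-dec all? (λ p → parity p ℙ.≟ ε) π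

p-de p-do : ℤ → ℕ
p-de = count (distinctParts? 0ℙ)
p-do = count (distinctParts? 1ℙ)

p-do-length : Parity → ℤ → ℕ
p-do-length ε = count (λ π → distinctParts? 1ℙ π ×-dec (parity (length π) ℙ.≟ ε))

p′-do : ℤ → ℤ
p′-do n = + p-do-length 0ℙ n ℤ.- + p-do-length 1ℙ n

private
  Bounded : ℕ → ℕ → List ℕ → Set
  Bounded m n π = Linked _≥_ (m ∷ π) × All (0 <_) π × sum π ≡ n

  sound≤ : ∀ l m n {π} → π ∈ partitions≤ l m n → Bounded m n π
  sound≤ zero    m zero    (here refl) = [-] , [] , refl
  sound≤ (suc l) m zero    (here refl) = [-] , [] , refl
  sound≤ (suc l) m (suc n) π∈
    with i , i∈ , π∈′ ← find (∈-concatMap⁻ _ {xs = upTo (m ⊓ suc n)} π∈)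
    with ρ , ρ∈ , refl ← ∈-map⁻ _ π∈′
    with lk , pos , tot ← sound≤ l (suc i) (n ∸ i) ρ∈
    = m≤n⊓o⇒m≤n m (suc n) i< ∷ lk
    , s≤s z≤n ∷ pos
    , cong suc (trans (cong (λ t → i + t) tot) (m+[n∸m]≡n (s≤s⁻¹ (m≤n⊓o⇒m≤o m (suc n) i<))))
    where
    i< : i < m ⊓ suc n
    i< = ∈-upTo⁻ i∈

  complete≤ : ∀ l m n {π} → n ≤ l → Bounded m n π → π ∈ partitions≤ l m n
  complete≤ zero    m zero    {[]} _ _ = here refl
  complete≤ (suc l) m zero    {[]} _ _ = here refl
  complete≤ l       m zero    {zero ∷ π}  _ (_ , () ∷ _ , _)
  complete≤ (suc l) m (suc n) {zero ∷ π}  _ (_ , () ∷ _ , _)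
  complete≤ (suc l) m (suc n) {suc i ∷ π} (s≤s n≤l) (i<m ∷ lk , _ ∷ pos , refl) =
    ∈-concatMap⁺ _ (lose (∈-upTo⁺ (⊓-glb i<m (s≤s (m≤m+n i (sum π)))))
      (∈-map⁺ _ (complete≤ l (suc i) (n ∸ i) (≤-trans (m∸n≤m n i) n≤l)
        (lk , pos , sym (m+n∸m≡n i (sum π))))))

  unique≤ : ∀ l m n → Unique (partitions≤ l m n)
  unique≤ zero    m zero    = [] ∷ []
  unique≤ (suc l) m zero    = [] ∷ []
  unique≤ zero    m (suc n) = []
  unique≤ (suc l) m (suc n) = Unique.concat⁺
    (All.map⁺ (All.universal (λ i → Unique.map⁺ ∷-injectiveʳ (unique≤ l (suc i) (n ∸ i))) _))
    (AllPairs.map⁺ (AllPairs.map disjoint (Unique.upTo⁺ (m ⊓ suc n))))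
    where
    disjoint : ∀ {i j} → i ≢ j →
      Disjoint (map (suc i ∷_) (partitions≤ l (suc i) (n ∸ i)))
               (map (suc j ∷_) (partitions≤ l (suc j) (n ∸ j)))
    disjoint i≢j (π∈ , π∈′)
      with _ , _ , eq ← ∈-map⁻ _ π∈ | _ , _ , eq′ ← ∈-map⁻ _ π∈′
      = i≢j (suc-injective (∷-injectiveˡ (trans (sym eq) eq′)))

  head≤sum : ∀ {π} → Linked _≥_ π → Linked _≥_ (sum π ∷ π)
  head≤sum {[]}    []  = [-]
  head≤sum {x ∷ π} lk = m≤m+n x (sum π) ∷ lk

partitions-sound : ∀ n {π} → π ∈ partitions n → IsPartition n π
partitions-sound (+ n) π∈ with lk , pos , refl ← sound≤ n n n π∈ =
  mkPartition (Linked.tail lk) pos refl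

partitions-complete : ∀ n {π} → IsPartition n π → π ∈ partitions n
partitions-complete _ {π} (mkPartition lk pos refl) =
  complete≤ (sum π) (sum π) (sum π) ≤-refl (head≤sum lk , pos , refl)

partitions-unique : ∀ n → Unique (partitions n)
partitions-unique (+ n)    = unique≤ n n n
partitions-unique -[1+ _ ] = []

{-# OPTIONS --safe #-}
module Submission where

-- Write a partition counted by B_ε(j, n) as its smallest part s, taken j times, together with
-- the list L of its larger parts, which lie in s + 1, s + 3, ….  For s = t + 2 these admissible
-- values are those for t without t + 1, so splitting the lists admissible for t by whether they
-- contain t + 1 matches the pairs (t + 2, L) counted by B_ε(k, n) and by B_ε′(k − 1, n − 1),
-- where ε′ is the opposite of ε, with (t, L ∪ {t + 1}) and (t, L).  This gives
--   B_ε(k, n) + B_ε′(k − 1, n − 1)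
--     = p_de(n − k) + p_do,ε′(n − 2k + 1) + B_ε′(k − 1, n − 2k + 1),
-- the first two terms on the right coming from s = 1 and from t = 0.  Adding and subtracting
-- the cases ε = 0, 1 yields both identities.

open import Defs

open import Data.Nat.Base using (ℕ; _≤_; _+_; _*_; _∸_)
open import Data.Integer.Base as ℤ using (+_)
open import Data.Product.Base using (_×_)
open import Relation.Binary.PropositionalEquality using (_≡_)

open import Data.Integer.Base using (ℤ)
import Data.Integer.Properties as ℤ
import Data.Integer.Tactic.RingSolver as ℤ-Solver
open import Data.List.Base using (List; []; _∷_; _++_; _∷ʳ_; filter; length; map; replicate)
open import Data.List.Extrema.Nat using (min≤⊤; min≤xs; argmin-sel)
open import Data.List.Membership.Propositional using (_∈_)
open import Data.List.Membership.Propositional.Properties using (∈-++⁺ˡ; ∈-++⁺ʳ; ∈-++⁻; ∈-filter⁺; ∈-filter⁻; ∈-map⁺; ∈-map⁻)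
open import Data.List.Membership.Propositional.Properties.WithK using (unique∧set⇒bag)
open import Data.List.Properties using (filter-++; filter-accept; filter-all; filter-none; filter-reject; length-++; length-map; length-replicate; ++-identityʳ; ∷ʳ-injectiveˡ)
open import Data.List.Relation.Binary.BagAndSetEquality using (∼bag⇒↭)
open import Data.List.Relation.Binary.Permutation.Propositional.Properties using (↭-length)
open import Data.List.Relation.Unary.All as All using (All; []; _∷_)
import Data.List.Relation.Unary.All.Properties as All
open import Data.List.Relation.Unary.AllPairs as AllPairs using (AllPairs; []; _∷_)
import Data.List.Relation.Unary.AllPairs.Properties as AllPairs
open import Data.List.Relation.Unary.Any using (here; there)
open import Data.List.Relation.Unary.Linked.Properties using (AllPairs⇒Linked; Linked⇒AllPairs)
open import Data.List.Relation.Unary.Unique.Propositional using (Unique)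
import Data.List.Relation.Unary.Unique.Propositional.Properties as Unique
open import Data.Nat.Base using (zero; suc; _<_; _>_; _≥_; z≤n; s≤s; z<s; parity)
open import Data.Nat.ListAction using (sum)
open import Data.Nat.ListAction.Properties using (sum-++)
open import Data.Nat.Properties
import Data.Nat.Tactic.RingSolver as ℕ-Solver
open import Data.Parity.Base using (Parity; 0ℙ; 1ℙ; _⁻¹)
import Data.Parity.Properties as ℙ
open import Data.Product.Base using (∃; _,_; proj₁; proj₂; map₁)
open import Data.Product.Properties using (,-injectiveˡ; ,-injectiveʳ)
open import Data.Sum.Base using (_⊎_; inj₁; inj₂; [_,_]′)
open import Data.Sum.Properties using (inj₁-injective; inj₂-injective)
open import Function.Base using (id; _∘_; flip)
open import Function.Bundles using (mk⇔)
open import Relation.Binary.PropositionalEquality using (_≢_; refl; sym; trans; cong; cong₂; subst; subst₂; module ≡-Reasoning)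
open import Relation.Nullary.Decidable using (yes; no)
open import Relation.Nullary.Negation using (contradiction)
open import Relation.Unary using (Decidable)

-- Counting by duplicate-free enumerations

record HasCard {A : Set} (P : A → Set) (c : ℕ) : Set where
  field
    elements : List A
    unique   : Unique elements
    sound    : ∀ {x} → x ∈ elements → P x
    complete : ∀ {x} → P x → x ∈ elements
    size     : length elements ≡ c

open HasCard

private
  variable
    A   : Set
    P Q : A → Set
    c d : ℕ

-- Duplicate-free lists with the same members are permutations of each other. This turns a bijection
-- into an equation between counts.
hasCard-functional : HasCard P c → HasCard P d → c ≡ d
hasCard-functional C D = trans (sym (size C)) (trans
  (↭-length (∼bag⇒↭ (unique∧set⇒bag (unique C) (unique D)
    (mk⇔ (complete D ∘ sound C) (complete C ∘ sound D)))))
  (size D))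

-- Working on the sum type keeps the two families apart even where they overlap, and lets them
-- consist of objects of different types.
hasCard-⊎ : HasCard P c → HasCard Q d → HasCard [ P , Q ]′ (c + d)
hasCard-⊎ {P = P} {Q = Q} C D = record
  { elements = map inj₁ (elements C) ++ map inj₂ (elements D)
  ; unique   = Unique.++⁺ (Unique.map⁺ inj₁-injective (unique C))
                          (Unique.map⁺ inj₂-injective (unique D)) disjoint
  ; sound    = λ x∈ → [ soundˡ , soundʳ ]′ (∈-++⁻ _ x∈)
  ; complete = λ { {inj₁ _} p → ∈-++⁺ˡ (∈-map⁺ inj₁ (complete C p))
                 ; {inj₂ _} q → ∈-++⁺ʳ _ (∈-map⁺ inj₂ (complete D q)) }
  ; size     = trans (length-++ (map inj₁ (elements C)))
                     (cong₂ _+_ (trans (length-map _ (elements C)) (size C))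
                                (trans (length-map _ (elements D)) (size D)))
  }
  where
  disjoint : ∀ {x} → (x ∈ map inj₁ (elements C)) × (x ∈ map inj₂ (elements D)) → _
  disjoint (x∈ , x∈′) with ∈-map⁻ inj₁ x∈ | ∈-map⁻ inj₂ x∈′
  ... | _ , _ , refl | _ , _ , ()

  soundˡ : ∀ {x} → x ∈ map inj₁ (elements C) → [ P , Q ]′ x
  soundˡ x∈ with _ , y∈ , refl ← ∈-map⁻ inj₁ x∈ = sound C y∈

  soundʳ : ∀ {x} → x ∈ map inj₂ (elements D) → [ P , Q ]′ x
  soundʳ x∈ with _ , y∈ , refl ← ∈-map⁻ inj₂ x∈ = sound D y∈

record BijectionOn {A A′ : Set} (P : A → Set) (Q : A′ → Set) (f : A → A′) : Set where
  field
    maps       : ∀ {x} → P x → Q (f x)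
    injective  : ∀ {x y} → P x → P y → f x ≡ f y → x ≡ y
    surjective : ∀ {y} → Q y → ∃ λ x → P x × f x ≡ y

hasCard-bijection : ∀ {f} → BijectionOn P Q f → HasCard P c → HasCard Q c
hasCard-bijection {P = P} {Q = Q} {f = f} bij C = record
  { elements = map f (elements C)
  ; unique   = unique-map (All.tabulate (sound C)) (unique C)
  ; sound    = sound′
  ; complete = complete′
  ; size     = trans (length-map f (elements C)) (size C)
  }
  where
  open BijectionOn bij

  -- `f` may fail to be injective outside `P`, so the proof that all entries satisfy `P` is carried
  -- along the list.
  unique-map : ∀ {xs} → All P xs → Unique xs → Unique (map f xs)
  unique-map []         []         = []
  unique-map (px ∷ pxs) (x∉ ∷ xs!) =
    All.map⁺ (All.zipWith (λ (x≢y , py) → x≢y ∘ injective px py) (x∉ , pxs)) ∷ unique-map pxs xs!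

  sound′ : ∀ {y} → y ∈ map f (elements C) → Q y
  sound′ y∈ with _ , x∈ , refl ← ∈-map⁻ f y∈ = maps (sound C x∈)

  complete′ : ∀ {y} → Q y → y ∈ map f (elements C)
  complete′ q with _ , p , refl ← surjective q = ∈-map⁺ f (complete C p)

equivalent⇒bijectionOn : (∀ {x} → P x → Q x) → (∀ {x} → Q x → P x) → BijectionOn P Q id
equivalent⇒bijectionOn P⇒Q Q⇒P = record
  { maps       = P⇒Q
  ; injective  = λ _ _ x≡y → x≡y
  ; surjective = λ q → _ , Q⇒P q , refl
  }

-- The properties of the enumeration `partitions` enter only here; afterwards counts are compared
-- through the predicates they count.
hasCard-count : ∀ {P : List ℕ → Set} (P? : Decidable P) z →
                HasCard (λ π → IsPartition z π × P π) (count P? z)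
hasCard-count P? z = record
  { elements = filter P? (partitions z)
  ; unique   = Unique.filter⁺ P? (partitions-unique z)
  ; sound    = λ π∈ → map₁ (partitions-sound z) (∈-filter⁻ P? π∈)
  ; complete = λ (part , p) → ∈-filter⁺ P? (partitions-complete z part) p
  ; size     = refl
  }

-- Parity and the admissible larger parts

≢⇒≡⁻¹ : ∀ {p q} → p ≢ q → p ≡ q ⁻¹
≢⇒≡⁻¹ {0ℙ} {0ℙ} p≢q = contradiction refl p≢q
≢⇒≡⁻¹ {0ℙ} {1ℙ} _   = refl
≢⇒≡⁻¹ {1ℙ} {0ℙ} _   = refl
≢⇒≡⁻¹ {1ℙ} {1ℙ} p≢q = contradiction refl p≢q

≡⁻¹⇒≢ : ∀ {p q} → p ≡ q ⁻¹ → p ≢ q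
≡⁻¹⇒≢ p≡q⁻¹ p≡q = ℙ.p≢p⁻¹ _ (trans (sym p≡q) p≡q⁻¹)

parity-suc : ∀ n → parity (suc n) ≡ parity n ⁻¹
parity-suc zero          = refl
parity-suc (suc zero)    = refl
parity-suc (suc (suc n)) = parity-suc n

-- The parts larger than the smallest part s of an element of Spt_do.
record DistinctAbove (s : ℕ) (L : List ℕ) : Set where
  constructor mkAbove
  field
    decreasing : AllPairs _>_ L
    above      : All (s <_) L
    opposite   : All (λ p → parity p ≢ parity s) L

open DistinctAbove

-- The admissible values for `s` are `s + 1`, `s + 3`, ...; without the first, all exceed `2 + s`,
-- which itself is excluded because it has the parity of `s`.
parity-gap : ∀ {s p} → s < p → parity p ≢ parity s → p ≢ suc s → 2 + s < p
parity-gap s<p p≢s p≢1+s =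
  ≤∧≢⇒< (≤∧≢⇒< s<p (p≢1+s ∘ sym)) λ { refl → p≢s refl }

-- `suc s` is admissible for `s` and smaller than everything admissible for `2 + s`, so in a
-- decreasing list it goes last.
distinctAbove-snoc : ∀ {s L} → DistinctAbove (2 + s) L → DistinctAbove s (L ∷ʳ suc s)
distinctAbove-snoc {s} (mkAbove dec ab op) = mkAbove
  (AllPairs.++⁺ dec ([] ∷ []) (All.map (λ 2+s<p → <⇒≤ 2+s<p ∷ []) ab))
  (All.++⁺ (All.map (<-trans (m<n+m s z<s)) ab) (≤-refl ∷ []))
  (All.++⁺ op (≡⁻¹⇒≢ (parity-suc s) ∷ []))

distinctAbove-weaken : ∀ {s L} → DistinctAbove (2 + s) L → DistinctAbove s L
distinctAbove-weaken {s} (mkAbove dec ab op) = mkAbove dec (All.map (<-trans (m<n+m s z<s)) ab) op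

-- Inverts the two maps above. After a head `suc s` the tail would have to lie strictly between `s`
-- and `suc s`, so it is empty; any other head exceeds `2 + s` by `parity-gap`, and the tail is
-- split recursively.
distinctAbove-split : ∀ {s L} → DistinctAbove s L →
  DistinctAbove (2 + s) L ⊎ ∃ λ L′ → DistinctAbove (2 + s) L′ × L′ ∷ʳ suc s ≡ L
distinctAbove-split {s} {[]}    (mkAbove [] [] []) = inj₁ (mkAbove [] [] [])
distinctAbove-split {s} {p ∷ L} (mkAbove (p>L ∷ dec) (s<p ∷ ab) (p≢s ∷ op))
  with p ≟ suc s
... | yes refl = inj₂ ([] , mkAbove [] [] [] , cong (suc s ∷_) (sym (nothing-between p>L ab)))
  where
  nothing-between : ∀ {L} → All (suc s >_) L → All (s <_) L → L ≡ []
  nothing-between []          []        = refl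
  nothing-between (p<1+s ∷ _) (s<p ∷ _) = contradiction p<1+s (≤⇒≯ s<p)
... | no p≢1+s with distinctAbove-split (mkAbove dec ab op)
...   | inj₁ (mkAbove dec′ ab′ op′) =
        inj₁ (mkAbove (p>L ∷ dec′) (parity-gap s<p p≢s p≢1+s ∷ ab′) (p≢s ∷ op′))
...   | inj₂ (L′ , mkAbove dec′ ab′ op′ , refl) =
        inj₂ (p ∷ L′ , mkAbove (All.++⁻ˡ L′ p>L ∷ dec′) (parity-gap s<p p≢s p≢1+s ∷ ab′) (p≢s ∷ op′) , refl)

strictly-decreasing : ∀ {L} → AllPairs _≥_ L → Unique L → AllPairs _>_ L
strictly-decreasing dec L! =
  AllPairs.zipWith (λ (x≥y , x≢y) → ≤∧≢⇒< x≥y (x≢y ∘ sym)) (dec , L!)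

>⇒unique : ∀ {L} → AllPairs _>_ L → Unique L
>⇒unique = AllPairs.map >⇒≢

-- Partitions into distinct parts

-- For `s = 0` these are the partitions of `z` into distinct odd parts, for `s = 1` those into
-- distinct even parts: the two boundary cases of the recurrence.
DistinctAboveSum : ℕ → ℤ → List ℕ → Set
DistinctAboveSum s z L = DistinctAbove s L × + sum L ≡ z

distinctParts⇒above : ∀ {s z π} → s ≤ 1 → IsPartition z π → DistinctParts (parity s ⁻¹) π →
                      DistinctAboveSum s z π
distinctParts⇒above {s} s≤1 (mkPartition dec pos tot) (π! , par) =
  mkAbove (strictly-decreasing (Linked⇒AllPairs (flip ≤-trans) dec) π!)
          (All.zipWith (λ (0<p , p≡) → larger-part s≤1 0<p (≡⁻¹⇒≢ p≡)) (pos , par))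
          (All.map ≡⁻¹⇒≢ par)
  , tot
  where
  larger-part : ∀ {s p} → s ≤ 1 → 0 < p → parity p ≢ parity s → s < p
  larger-part z≤n       0<p _   = 0<p
  -- A positive part that does not exceed 1 equals 1, which has the wrong parity.
  larger-part (s≤s z≤n) 0<p p≢1 = ≤∧≢⇒< 0<p λ { refl → p≢1 refl }

above⇒distinctParts : ∀ {s z π} → DistinctAboveSum s z π →
                      IsPartition z π × DistinctParts (parity s ⁻¹) π
above⇒distinctParts (mkAbove dec ab op , tot) =
  mkPartition (AllPairs⇒Linked (AllPairs.map <⇒≤ dec)) (All.map (≤-<-trans z≤n) ab) tot
  , >⇒unique dec , All.map ≢⇒≡⁻¹ op

hasCard-p-de : ∀ z → HasCard (DistinctAboveSum 1 z) (p-de z)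
hasCard-p-de z = hasCard-bijection
  (equivalent⇒bijectionOn (λ (part , dist) → distinctParts⇒above ≤-refl part dist) above⇒distinctParts)
  (hasCard-count (distinctParts? 0ℙ) z)

hasCard-p-do-length : ∀ ε z →
  HasCard (λ L → DistinctAboveSum 0 z L × parity (length L) ≡ ε) (p-do-length ε z)
hasCard-p-do-length ε z = hasCard-bijection
  (equivalent⇒bijectionOn
    (λ (part , dist , par) → distinctParts⇒above z≤n part dist , par)
    (λ (ab , par) → proj₁ (above⇒distinctParts ab) , proj₂ (above⇒distinctParts ab) , par))
  (hasCard-count _ z)

-- The recurrence yields only counts refined by length parity; this recovers `p-do` for the second
-- identity.
p-do-by-length : ∀ z → p-do-length 0ℙ z + p-do-length 1ℙ z ≡ p-do z
p-do-by-length z = hasCard-functional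
  (hasCard-bijection merge (hasCard-⊎ (hasCard-count _ z) (hasCard-count _ z)))
  (hasCard-count (distinctParts? 1ℙ) z)
  where
  HasLength : Parity → List ℕ → Set
  HasLength ε π = IsPartition z π × DistinctParts 1ℙ π × parity (length π) ≡ ε

  merge : BijectionOn [ HasLength 0ℙ , HasLength 1ℙ ]′
                      (λ π → IsPartition z π × DistinctParts 1ℙ π) [ id , id ]′
  merge = record
    { maps       = λ { {inj₁ _} (part , dist , _) → part , dist
                     ; {inj₂ _} (part , dist , _) → part , dist }
    ; injective  = λ { {inj₁ _} {inj₁ _} _ _ refl → refl
                     ; {inj₁ _} {inj₂ _} (_ , _ , even) (_ , _ , odd) refl →
                         contradiction (trans (sym even) odd) λ ()
                     ; {inj₂ _} {inj₁ _} (_ , _ , odd) (_ , _ , even) refl →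
                         contradiction (trans (sym even) odd) λ ()
                     ; {inj₂ _} {inj₂ _} _ _ refl → refl }
    ; surjective = surj
    }
    where
    surj : ∀ {π} → IsPartition z π × DistinctParts 1ℙ π → _
    surj {π} (part , dist) with parity (length π) in eq
    ... | 0ℙ = inj₁ π , (part , dist , eq) , refl
    ... | 1ℙ = inj₂ π , (part , dist , eq) , refl

-- Partitions counted by spt_do

smallest-≤ : ∀ π → All (smallest π ≤_) π
smallest-≤ []      = []
smallest-≤ (x ∷ π) = min≤⊤ x π ∷ min≤xs x π

smallest-∈ : ∀ π → π ≢ [] → smallest π ∈ π
smallest-∈ []      π≢[] = contradiction refl π≢[]
smallest-∈ (x ∷ π) _    = [ here , there ]′ (argmin-sel id x π)

smallest-unique : ∀ {s π} → s ∈ π → All (s ≤_) π → smallest π ≡ s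
smallest-unique {s} {x ∷ π} s∈ s≤ =
  ≤-antisym (All.lookup (smallest-≤ (x ∷ π)) s∈) (All.lookup s≤ (smallest-∈ (x ∷ π) λ ()))

all-≡⇒replicate : ∀ {s : ℕ} {L} → All (_≡ s) L → replicate (length L) s ≡ L
all-≡⇒replicate []           = refl
all-≡⇒replicate (refl ∷ L≡s) = cong (_ ∷_) (all-≡⇒replicate L≡s)

all-≤-≥⇒≡ : ∀ {s : ℕ} {L} → All (_≤ s) L → All (s ≤_) L → All (_≡ s) L
all-≤-≥⇒≡ L≤s s≤L = All.zipWith (λ (y≤s , s≤y) → ≤-antisym y≤s s≤y) (L≤s , s≤L)

-- In a decreasing list bounded below by `s`, everything after a first `s` equals `s`, so the larger
-- entries form a prefix.
decreasing-decompose : ∀ {s π} → AllPairs _≥_ π → All (s ≤_) π →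
  filter (s <?_) π ++ replicate (occurrences s π) s ≡ π
decreasing-decompose []          []         = refl
decreasing-decompose {s} {x ∷ π} (x≥π ∷ dec) (s≤x ∷ s≤π) with m≤n⇒m<n∨m≡n s≤x
... | inj₁ s<x
  rewrite filter-accept (s <?_) {x} {π} s<x
        | filter-reject (_≟ s) {x} {π} (>⇒≢ s<x)
        = cong (x ∷_) (decreasing-decompose dec s≤π)
... | inj₂ refl
  rewrite filter-reject (s <?_) {s} {π} (<-irrefl refl)
        | filter-none (s <?_) (All.map ≤⇒≯ x≥π)
        | filter-accept (_≟ s) {s} {π} refl
        | filter-all (_≟ s) (all-≤-≥⇒≡ x≥π s≤π)
        = cong (s ∷_) (all-≡⇒replicate (all-≤-≥⇒≡ x≥π s≤π))

-- A pair (s , L) stands for L ++ replicate j s; s = 0 is allowed and gives the partitions into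
-- distinct odd parts.
record IsCode (j : ℕ) (ε : Parity) (z : ℤ) (sL : ℕ × List ℕ) : Set where
  constructor mkCode
  field
    distinctAbove : DistinctAbove (proj₁ sL) (proj₂ sL)
    lengthParity  : parity (length (proj₂ sL)) ≡ ε
    codeSum       : + (sum (proj₂ sL) + j * proj₁ sL) ≡ z

sum-replicate : ∀ j s → sum (replicate j s) ≡ j * s
sum-replicate zero    s = refl
sum-replicate (suc j) s = cong (λ t → s + t) (sum-replicate j s)

SptDo : ℕ → Parity → ℤ → List ℕ → Set
SptDo j ε z π = IsPartition z π × IsSptDo j π × parity (length (larger π)) ≡ ε

PositiveCode : ℕ → Parity → ℤ → ℕ × List ℕ → Set
PositiveCode j ε z sL = 0 < proj₁ sL × IsCode j ε z sL

encode : List ℕ → ℕ × List ℕ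
encode π = smallest π , larger π

decode : ℕ → ℕ × List ℕ → List ℕ
decode j (s , L) = L ++ replicate j s

decode-encode : ∀ {j ε z π} → SptDo j ε z π → decode j (encode π) ≡ π
decode-encode {π = π} (mkPartition dec _ _ , (_ , refl , _) , _) =
  decreasing-decompose (Linked⇒AllPairs (flip ≤-trans) dec) (smallest-≤ π)

-- The multiplicity `suc j` guarantees a copy of `s`, which is then the minimum; with no copy, the
-- smallest part would be read off from `L`.
encode-decode : ∀ {j s L} → All (s <_) L → encode (decode (suc j) (s , L)) ≡ (s , L)
encode-decode {j} {s} {L} s<L = cong₂ _,_ small large
  where
  π = decode (suc j) (s , L)

  small : smallest π ≡ s
  small = smallest-unique (∈-++⁺ʳ L (here refl))
    (All.++⁺ (All.map <⇒≤ s<L) (All.replicate⁺ (suc j) ≤-refl))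

  large : larger π ≡ L
  large = begin
    filter (smallest π <?_) π
      ≡⟨ cong (λ t → filter (t <?_) π) small ⟩
    filter (s <?_) (L ++ replicate (suc j) s)
      ≡⟨ filter-++ (s <?_) L _ ⟩
    filter (s <?_) L ++ filter (s <?_) (replicate (suc j) s)
      ≡⟨ cong₂ _++_ (filter-all (s <?_) s<L)
           (filter-none (s <?_) (All.replicate⁺ (suc j) (<-irrefl refl))) ⟩
    L ++ []
      ≡⟨ ++-identityʳ L ⟩
    L ∎
    where open ≡-Reasoning

occurrences-decode : ∀ {j s L} → All (s <_) L → occurrences s (decode j (s , L)) ≡ j
occurrences-decode {j} {s} {L} s<L = begin
  length (filter (_≟ s) (L ++ replicate j s))
    ≡⟨ cong length (filter-++ (_≟ s) L _) ⟩
  length (filter (_≟ s) L ++ filter (_≟ s) (replicate j s))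
    ≡⟨ cong length (cong₂ _++_ (filter-none (_≟ s) (All.map >⇒≢ s<L))
         (filter-all (_≟ s) (All.replicate⁺ j refl))) ⟩
  length (replicate j s)
    ≡⟨ length-replicate j ⟩
  j ∎
  where open ≡-Reasoning

sum-decode : ∀ j s L → sum (decode j (s , L)) ≡ sum L + j * s
sum-decode j s L = trans (sum-++ L _) (cong (λ t → sum L + t) (sum-replicate j s))

encode-isCode : ∀ {j ε z π} → SptDo j ε z π → PositiveCode j ε z (encode π)
encode-isCode {j} {ε} {z} {π}
  spt@(mkPartition dec pos tot , (π≢[] , occ , larger! , op) , par) =
  All.lookup pos (smallest-∈ π π≢[])
  , mkCode (mkAbove
      (strictly-decreasing (AllPairs.filter⁺ _ (Linked⇒AllPairs (flip ≤-trans) dec)) larger!)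
      (All.all-filter _ π) op)
    par
    (trans (cong +_ (trans (sym (sum-decode j (smallest π) (larger π))) (cong sum (decode-encode spt)))) tot)

decode-isSptDo : ∀ {j ε z sL} → PositiveCode (suc j) ε z sL → SptDo (suc j) ε z (decode (suc j) sL)
decode-isSptDo {j} {ε} {z} {s , L} (0<s , mkCode (mkAbove dec ab op) par tot) =
  mkPartition
    (AllPairs⇒Linked (AllPairs.++⁺ (AllPairs.map <⇒≤ dec) (replicate-≥ (suc j))
      (All.map (λ s<p → All.replicate⁺ (suc j) (<⇒≤ s<p)) ab)))
    (All.++⁺ (All.map (≤-<-trans z≤n) ab) (All.replicate⁺ (suc j) 0<s))
    (trans (cong +_ (sum-decode (suc j) s L)) tot)
  , (nonempty L
    , trans (cong (λ t → occurrences t π) small) (occurrences-decode ab)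
    , subst Unique (sym large) (>⇒unique dec)
    , subst₂ (λ s L → All (λ p → parity p ≢ parity s) L) (sym small) (sym large) op)
  , trans (cong (parity ∘ length) large) par
  where
  π = decode (suc j) (s , L)

  small : smallest π ≡ s
  small = ,-injectiveˡ (encode-decode {j} ab)

  large : larger π ≡ L
  large = ,-injectiveʳ (encode-decode {j} ab)

  nonempty : ∀ L → L ++ replicate (suc j) s ≢ []
  nonempty []      ()
  nonempty (_ ∷ _) ()

  replicate-≥ : ∀ m → AllPairs _≥_ (replicate m s)
  replicate-≥ zero    = []
  replicate-≥ (suc m) = All.replicate⁺ m ≤-refl ∷ replicate-≥ m

hasCard-B : ∀ j ε z → HasCard (PositiveCode (suc j) ε z) (B ε (suc j) z)
hasCard-B j ε z = hasCard-bijection encoding (hasCard-count _ z)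
  where
  encoding : BijectionOn (SptDo (suc j) ε z) (PositiveCode (suc j) ε z) encode
  encoding = record
    { maps       = encode-isCode
    ; injective  = λ spt spt′ eq →
        trans (sym (decode-encode spt)) (trans (cong (decode (suc j)) eq) (decode-encode spt′))
    ; surjective = λ code → _ , decode-isSptDo code ,
        encode-decode (above (IsCode.distinctAbove (proj₂ code)))
    }

-- Split by `s = 0` or `s > 0`. Copies of 0 add nothing to the sum, so the codes with `s = 0` are
-- the partitions into distinct odd parts.
hasCard-code : ∀ j ε z → HasCard (IsCode (suc j) ε z) (p-do-length ε z + B ε (suc j) z)
hasCard-code j ε z =
  hasCard-bijection merge (hasCard-⊎ (hasCard-p-do-length ε z) (hasCard-B j ε z))
  where
  no-smallest : ∀ L → sum L + suc j * 0 ≡ sum L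
  no-smallest L = trans (cong (λ t → sum L + t) (*-zeroʳ (suc j))) (+-identityʳ (sum L))

  merge : BijectionOn
    [ (λ L → DistinctAboveSum 0 z L × parity (length L) ≡ ε) , PositiveCode (suc j) ε z ]′
    (IsCode (suc j) ε z) [ (0 ,_) , id ]′
  merge = record
    { maps       = λ { {inj₁ L} ((ab , tot) , par) → mkCode ab par (trans (cong +_ (no-smallest L)) tot)
                     ; {inj₂ _} (_ , code) → code }
    ; injective  = λ { {inj₁ _} {inj₁ _} _ _ refl → refl
                     ; {inj₁ _} {inj₂ _} _ (() , _) refl
                     ; {inj₂ _} {inj₁ _} (() , _) _ refl
                     ; {inj₂ _} {inj₂ _} _ _ refl → refl }
    ; surjective = λ { {zero , L} (mkCode ab par tot) →
                         inj₁ L , ((ab , trans (cong +_ (sym (no-smallest L))) tot) , par) , refl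
                     ; {suc s , L} code → inj₂ (suc s , L) , (z<s , code) , refl }
    }

-- The recurrence

-- Arguments such as n - 2k + 1 can be negative; moving the subtracted term across leaves equations
-- between naturals.
sub-add⇒ : ∀ {a} n b c → + a ≡ + n ℤ.- + b ℤ.+ + c → a + b ≡ n + c
sub-add⇒ {a} n b c eq = ℤ.+-injective (trans (cong (ℤ._+ + b) eq) (cancel (+ n) (+ b) (+ c)))
  where
  cancel : ∀ n b c → n ℤ.- b ℤ.+ c ℤ.+ b ≡ n ℤ.+ c
  cancel = ℤ-Solver.solve-∀

sub-add⇐ : ∀ {a} n b c → a + b ≡ n + c → + a ≡ + n ℤ.- + b ℤ.+ + c
sub-add⇐ {a} n b c eq = trans (cancel (+ a) (+ b))
  (trans (cong (ℤ._- + b) (cong +_ eq)) (swap (+ n) (+ b) (+ c)))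
  where
  cancel : ∀ a b → a ≡ a ℤ.+ b ℤ.- b
  cancel = ℤ-Solver.solve-∀

  swap : ∀ n b c → n ℤ.+ c ℤ.- b ≡ n ℤ.- b ℤ.+ c
  swap = ℤ-Solver.solve-∀

sub⇒ : ∀ {a} n b → + a ≡ + n ℤ.- + b → a + b ≡ n
sub⇒ {a} n b eq =
  trans (sub-add⇒ n b 0 (trans eq (sym (ℤ.+-identityʳ _)))) (+-identityʳ n)

sub⇐ : ∀ {a} n b → a + b ≡ n → + a ≡ + n ℤ.- + b
sub⇐ {a} n b eq =
  trans (sub-add⇐ n b 0 (trans eq (sym (+-identityʳ n)))) (ℤ.+-identityʳ _)

-- Here k is `suc j`, so `zₖ` is n - k and `z₂ₖ` is n - 2k + 1.
module Recurrence (j : ℕ) (ε : Parity) (n : ℕ) where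

  z z₁ zₖ z₂ₖ : ℤ
  z   = + n
  z₁  = + n ℤ.- + 1
  zₖ  = + n ℤ.- + suc j
  z₂ₖ = + n ℤ.- + (2 * suc j) ℤ.+ + 1

  Source : (ℕ × List ℕ) ⊎ (ℕ × List ℕ) → Set
  Source = [ PositiveCode (suc j) ε z , PositiveCode j (ε ⁻¹) z₁ ]′

  -- The first summand has no length condition: at `s = 1` the two halves of `Source` supply the two
  -- length parities.
  Target : List ℕ ⊎ (ℕ × List ℕ) → Set
  Target = [ DistinctAboveSum 1 zₖ , IsCode j (ε ⁻¹) z₂ₖ ]′

  -- The values at s = 0 are dummies: codes in Source have s > 0.
  φ : (ℕ × List ℕ) ⊎ (ℕ × List ℕ) → List ℕ ⊎ (ℕ × List ℕ)
  φ (inj₁ (zero , L))        = inj₁ L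
  φ (inj₁ (suc zero , L))    = inj₁ L
  φ (inj₁ (suc (suc t) , L)) = inj₂ (t , L ∷ʳ suc t)
  φ (inj₂ (zero , L))        = inj₁ L
  φ (inj₂ (suc zero , L))    = inj₁ L
  φ (inj₂ (suc (suc t) , L)) = inj₂ (t , L)

  -- At `s = 1`, removing k ones from n or k - 1 ones from n - 1 leaves n - k either way.
  sum-one₁ : ∀ L → sum L + suc j * 1 ≡ sum L + suc j
  sum-one₁ L = cong (λ t → sum L + t) (*-identityʳ (suc j))

  sum-one₂ : ∀ L → sum L + j * 1 + 1 ≡ sum L + suc j
  sum-one₂ L = identity (sum L) j
    where
    identity : ∀ l j → l + j * 1 + 1 ≡ l + (1 + j)
    identity = ℕ-Solver.solve-∀

  -- Passing from k copies of t + 2 to k - 1 copies of t and one part t + 1 lowers the sum by 2k -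
  -- 1; the 1 is moved to the left.
  sum-two₁ : ∀ t L → sum L + suc j * (2 + t) + 1 ≡ sum (L ∷ʳ suc t) + j * t + 2 * suc j
  sum-two₁ t L = trans (identity (sum L) j t)
    (cong (λ u → u + j * t + 2 * suc j) (sym (sum-++ L (suc t ∷ []))))
    where
    identity : ∀ l j t → l + (1 + j) * (2 + t) + 1 ≡ l + (1 + t + 0) + j * t + 2 * (1 + j)
    identity = ℕ-Solver.solve-∀

  -- Lowering k - 1 copies from t + 2 to t costs 2k - 2. One `+ 1` comes from the total n - 1, the
  -- other from `z₂ₖ`.
  sum-two₂ : ∀ t L → sum L + j * (2 + t) + 1 + 1 ≡ sum L + j * t + 2 * suc j
  sum-two₂ t L = identity (sum L) j t
    where
    identity : ∀ l j t → l + j * (2 + t) + 1 + 1 ≡ l + j * t + 2 * (1 + j)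
    identity = ℕ-Solver.solve-∀

  -- Since appending `suc t` flips the length parity, the two halves of `Source` carry opposite
  -- parities.
  parity-snoc : ∀ (L : List ℕ) x → parity (length (L ∷ʳ x)) ≡ parity (length L) ⁻¹
  parity-snoc L x = trans (cong parity (trans (length-++ L) (+-comm (length L) 1))) (parity-suc (length L))

  φ-maps : ∀ {x} → Source x → Target (φ x)
  φ-maps {inj₁ (suc zero , L)} (_ , mkCode ab par tot) =
    ab , sub⇐ n (suc j) (trans (sym (sum-one₁ L)) (ℤ.+-injective tot))
  φ-maps {inj₁ (suc (suc t) , L)} (_ , mkCode ab par tot) =
    mkCode (distinctAbove-snoc ab) (trans (parity-snoc L (suc t)) (cong _⁻¹ par))
      (sub-add⇐ n (2 * suc j) 1 (trans (sym (sum-two₁ t L)) (cong (_+ 1) (ℤ.+-injective tot))))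
  φ-maps {inj₂ (suc zero , L)} (_ , mkCode ab par tot) =
    ab , sub⇐ n (suc j) (trans (sym (sum-one₂ L)) (sub⇒ n 1 tot))
  φ-maps {inj₂ (suc (suc t) , L)} (_ , mkCode ab par tot) =
    mkCode (distinctAbove-weaken ab) par
      (sub-add⇐ n (2 * suc j) 1 (trans (sym (sum-two₂ t L)) (cong (_+ 1) (sub⇒ n 1 tot))))

  opposite-lengths : ∀ {L : List ℕ} {C : Set} → parity (length L) ≡ ε → parity (length L) ≡ ε ⁻¹ → C
  opposite-lengths par par′ = contradiction (trans (sym par) par′) (ℙ.p≢p⁻¹ ε)

  snoc-not-above : ∀ {t L} {C : Set} → DistinctAbove (2 + t) (L ∷ʳ suc t) → C
  snoc-not-above {t} {L} (mkAbove _ ab _) =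
    contradiction (All.lookup ab (∈-++⁺ʳ L (here refl))) (≤⇒≯ (n≤1+n (suc t)))

  -- Images of the two halves are told apart by length parity when `s = 1`, and by whether the list
  -- contains `suc t` when `s = 2 + t`.
  φ-injective : ∀ {x y} → Source x → Source y → φ x ≡ φ y → x ≡ y
  φ-injective {inj₁ (suc zero , L)} {inj₁ (suc zero , _)} _ _ refl = refl
  φ-injective {inj₁ (suc zero , L)} {inj₂ (suc zero , _)} (_ , c) (_ , c′) refl =
    opposite-lengths {L} (IsCode.lengthParity c) (IsCode.lengthParity c′)
  φ-injective {inj₂ (suc zero , L)} {inj₁ (suc zero , _)} (_ , c) (_ , c′) refl =
    opposite-lengths {L} (IsCode.lengthParity c′) (IsCode.lengthParity c)
  φ-injective {inj₂ (suc zero , _)} {inj₂ (suc zero , _)} _ _ refl = refl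
  φ-injective {inj₁ (suc (suc t) , L)} {inj₁ (suc (suc u) , L′)} _ _ eq
    with refl ← ,-injectiveˡ (inj₂-injective eq)
    with refl ← ∷ʳ-injectiveˡ L L′ (,-injectiveʳ (inj₂-injective eq)) = refl
  φ-injective {inj₁ (suc (suc t) , L)} {inj₂ (suc (suc _) , _)} _ (_ , c′) refl =
    snoc-not-above {t} {L} (IsCode.distinctAbove c′)
  φ-injective {inj₂ (suc (suc _) , _)} {inj₁ (suc (suc t) , L)} (_ , c) _ refl =
    snoc-not-above {t} {L} (IsCode.distinctAbove c)
  φ-injective {inj₂ (suc (suc _) , _)} {inj₂ (suc (suc _) , _)} _ _ refl = refl

  -- The same two criteria choose the half in which the preimage lies.
  φ-surjective : ∀ {y} → Target y → ∃ λ x → Source x × φ x ≡ y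
  φ-surjective {inj₁ L} (ab , tot) with parity (length L) ℙ.≟ ε
  ... | yes par = inj₁ (1 , L) ,
        (z<s , mkCode ab par (cong +_ (trans (sum-one₁ L) (sub⇒ n (suc j) tot)))) , refl
  ... | no ¬par = inj₂ (1 , L) ,
        (z<s , mkCode ab (≢⇒≡⁻¹ ¬par) (sub⇐ n 1 (trans (sum-one₂ L) (sub⇒ n (suc j) tot)))) , refl
  φ-surjective {inj₂ (t , L)} (mkCode ab par tot) with distinctAbove-split ab
  -- The cancelled 1 is the final `+ 1` of `z₂ₖ`.
  ... | inj₁ ab′ = inj₂ (2 + t , L) ,
        (z<s , mkCode ab′ par
          (sub⇐ n 1 (+-cancelʳ-≡ 1 _ _ (trans (sum-two₂ t L) (sub-add⇒ n (2 * suc j) 1 tot))))) , refl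
  ... | inj₂ (L′ , ab′ , refl) = inj₁ (2 + t , L′) ,
        (z<s , mkCode ab′ (ℙ.⁻¹-injective (trans (sym (parity-snoc L′ (suc t))) par))
          (cong +_ (+-cancelʳ-≡ 1 _ _ (trans (sum-two₁ t L′) (sub-add⇒ n (2 * suc j) 1 tot))))) , refl

  φ-bijection : BijectionOn Source Target φ
  φ-bijection = record
    { maps       = λ {x} → φ-maps {x}
    ; injective  = φ-injective
    ; surjective = φ-surjective
    }

-- Counts both sides of `φ-bijection`. Taking `j = suc i` makes k - 1 positive, as the
-- correspondence between codes and partitions requires.
B-recurrence : ∀ i ε n → let j = suc i ; z = + n ℤ.- + (2 * suc j) ℤ.+ + 1 in
  B ε (suc j) (+ n) + B (ε ⁻¹) j (+ n ℤ.- + 1)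
    ≡ p-de (+ n ℤ.- + suc j) + (p-do-length (ε ⁻¹) z + B (ε ⁻¹) j z)
B-recurrence i ε n = hasCard-functional
  (hasCard-bijection φ-bijection (hasCard-⊎ (hasCard-B (suc i) ε z) (hasCard-B i (ε ⁻¹) z₁)))
  (hasCard-⊎ (hasCard-p-de zₖ) (hasCard-code i (ε ⁻¹) z₂ₖ))
  where open Recurrence (suc i) ε n

-- The difference and the sum of the recurrences for the two parities

theorem3p1 : ∀ (k n : ℕ) → 2 ≤ k → 1 ≤ n →
    (spt′-do (k ∸ 1) (+ n ℤ.- + 1) ℤ.- spt′-do k (+ n)
    ≡ spt′-do (k ∸ 1) (+ n ℤ.- + (2 * k) ℤ.+ + 1) ℤ.+ p′-do (+ n ℤ.- + (2 * k) ℤ.+ + 1))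
    ×
    (spt-do k (+ n) + spt-do (k ∸ 1) (+ n ℤ.- + 1)
    ≡ spt-do (k ∸ 1) (+ n ℤ.- + (2 * k) ℤ.+ + 1) + 2 * p-de (+ n ℤ.- + k) + p-do (+ n ℤ.- + (2 * k) ℤ.+ + 1))
theorem3p1 (suc (suc i)) n (s≤s (s≤s z≤n)) _ = difference , total
  where
  k  = suc (suc i)
  j  = suc i
  z₁  = + n ℤ.- + 1
  z₂ₖ = + n ℤ.- + (2 * k) ℤ.+ + 1
  b₀ = B₀ k (+ n)
  b₁ = B₁ k (+ n)
  b₀′ = B₀ j z₁
  b₁′ = B₁ j z₁
  b₀″ = B₀ j z₂ₖ
  b₁″ = B₁ j z₂ₖ
  e  = p-de (+ n ℤ.- + k)
  d₀ = p-do-length 0ℙ z₂ₖ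
  d₁ = p-do-length 1ℙ z₂ₖ

  difference : (+ b₀′ ℤ.- + b₁′) ℤ.- (+ b₀ ℤ.- + b₁) ≡ (+ b₀″ ℤ.- + b₁″) ℤ.+ (+ d₀ ℤ.- + d₁)
  difference = begin
    (+ b₀′ ℤ.- + b₁′) ℤ.- (+ b₀ ℤ.- + b₁)
      -- Each count for k is paired with the count for k - 1 of opposite parity, as in the
      -- recurrence.
      ≡⟨ regroup (+ b₀) (+ b₁) (+ b₀′) (+ b₁′) ⟩
    + (b₁ + b₀′) ℤ.- + (b₀ + b₁′)
      ≡⟨ cong₂ (λ x y → + x ℤ.- + y) (B-recurrence i 1ℙ n) (B-recurrence i 0ℙ n) ⟩
    + (e + (d₀ + b₀″)) ℤ.- + (e + (d₁ + b₁″))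
      -- The term `e` does not depend on the parity, so it cancels here and is doubled in `total`.
      ≡⟨ cancel (+ e) (+ d₀) (+ d₁) (+ b₀″) (+ b₁″) ⟩
    (+ b₀″ ℤ.- + b₁″) ℤ.+ (+ d₀ ℤ.- + d₁) ∎
    where
    open ≡-Reasoning

    regroup : ∀ a b c d → (c ℤ.- d) ℤ.- (a ℤ.- b) ≡ (b ℤ.+ c) ℤ.- (a ℤ.+ d)
    regroup = ℤ-Solver.solve-∀

    cancel : ∀ e d₀ d₁ b₀ b₁ →
      (e ℤ.+ (d₀ ℤ.+ b₀)) ℤ.- (e ℤ.+ (d₁ ℤ.+ b₁)) ≡ (b₀ ℤ.- b₁) ℤ.+ (d₀ ℤ.- d₁)
    cancel = ℤ-Solver.solve-∀

  total : (b₀ + b₁) + (b₀′ + b₁′) ≡ (b₀″ + b₁″) + 2 * e + p-do z₂ₖ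
  total = begin
    (b₀ + b₁) + (b₀′ + b₁′)
      ≡⟨ regroup b₀ b₁ b₀′ b₁′ ⟩
    (b₀ + b₁′) + (b₁ + b₀′)
      ≡⟨ cong₂ _+_ (B-recurrence i 0ℙ n) (B-recurrence i 1ℙ n) ⟩
    (e + (d₁ + b₁″)) + (e + (d₀ + b₀″))
      ≡⟨ collect e d₀ d₁ b₀″ b₁″ ⟩
    (b₀″ + b₁″) + 2 * e + (d₀ + d₁)
      ≡⟨ cong (λ x → (b₀″ + b₁″) + 2 * e + x) (p-do-by-length z₂ₖ) ⟩
    (b₀″ + b₁″) + 2 * e + p-do z₂ₖ ∎
    where
    open ≡-Reasoning

    regroup : ∀ a b c d → (a + b) + (c + d) ≡ (a + d) + (b + c)
    regroup = ℕ-Solver.solve-∀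

    collect : ∀ e d₀ d₁ b₀ b₁ →
      (e + (d₁ + b₁)) + (e + (d₀ + b₀)) ≡ (b₀ + b₁) + 2 * e + (d₀ + d₁)
    collect = ℕ-Solver.solve-∀
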